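{- Let $G=(V,E)$ be a graph of treewidth $t$ and let $\mathcal{H}$ be a non-piercing family of subgraphs of $G$. Then there is a dual support $Q^*$ for $(G,\mathcal{H})$ with $\mathrm{tw}(Q^*)\le 2^{4(t+1)}$.
   Context: Subgraphs are identified with their vertex sets (induced subgraphs of $G$). A family $\mathcal{H}$ of connected subgraphs of $G$ is non-piercing if for all $H,H'\in\mathcal{H}$ the subgraph of $G$ induced on $V(H)\setminus V(H')$ is connected. A dual support for $(G,\mathcal{H})$ is a graph $Q^*$ with vertex set $\mathcal{H}$ such that for every $v\in V$, the set $\mathcal{H}_v=\{H\in\mathcal{H}: v\in V(H)\}$ induces a connected subgraph of $Q^*$. $\mathrm{tw}$ denotes treewidth. -}

module Defs where

open import Data.Nat using (ℕ; zero; suc; _≤_; _+_; _*_; _^_)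
open import Data.Fin using (Fin)
open import Data.Fin.Subset using (Subset; _∈_; _∉_; ∣_∣)
open import Data.Product using (Σ; ∃; _×_; _,_)
open import Data.Sum using (_⊎_)
open import Data.Unit using (⊤)
open import Relation.Nullary using (¬_)
open import Relation.Binary.PropositionalEquality using (_≡_)

record Graph (n : ℕ) : Set₁ where
  field
    Adj    : Fin n → Fin n → Set
    sym    : ∀ {u v} → Adj u v → Adj v u
    irrefl : ∀ {u} → ¬ Adj u u

data Walk {n : ℕ} (R : Fin n → Fin n → Set) (P : Fin n → Set) : Fin n → Fin n → Set where
  here : ∀ {u} → P u → Walk R P u u
  step : ∀ {u w v} → P u → R u w → Walk R P w v → Walk R P u v

-- The subgraph induced (w.r.t. edge relation R) on the vertex set P is connected.
-- (Convention: the empty vertex set counts as connected.)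
Connected : {n : ℕ} → (Fin n → Fin n → Set) → (Fin n → Set) → Set
Connected R P = ∀ u v → P u → P v → Walk R P u v

RemoveEdge : {n : ℕ} → (Fin n → Fin n → Set) → Fin n → Fin n → Fin n → Fin n → Set
RemoveEdge R a b x y = R x y × ¬ ((x ≡ a × y ≡ b) ⊎ (x ≡ b × y ≡ a))

AllVertices : {n : ℕ} → Fin n → Set
AllVertices _ = ⊤

record IsTree {m : ℕ} (T : Graph m) : Set where
  field
    nonempty  : Fin m
    connected : Connected (Graph.Adj T) AllVertices
    acyclic   : ∀ a b → Graph.Adj T a b →
                ¬ Walk (RemoveEdge (Graph.Adj T) a b) AllVertices a b

record TreeDecomposition {n : ℕ} (G : Graph n) (k : ℕ) : Set₁ where
  field
    m        : ℕ
    T        : Graph m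
    isTree   : IsTree T
    bag      : Fin m → Subset n
    covV     : ∀ v → ∃ λ i → v ∈ bag i
    covE     : ∀ u v → Graph.Adj G u v → ∃ λ i → (u ∈ bag i × v ∈ bag i)
    coherent : ∀ v → Connected (Graph.Adj T) (λ i → v ∈ bag i)
    width    : ∀ i → ∣ bag i ∣ ≤ suc k

TwLeq : {n : ℕ} → Graph n → ℕ → Set₁
TwLeq G k = TreeDecomposition G k

HasTreewidth : {n : ℕ} → Graph n → ℕ → Set₁
HasTreewidth G t = TwLeq G t × (∀ k → TwLeq G k → t ≤ k)

-- A family of m subgraphs of G (vertex subsets, identified with induced subgraphs).
Family : ℕ → ℕ → Set
Family n m = Fin m → Subset n

ConnectedFamily : {n m : ℕ} → Graph n → Family n m → Set
ConnectedFamily G ℋ = ∀ i → Connected (Graph.Adj G) (λ v → v ∈ ℋ i)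

NonPiercing : {n m : ℕ} → Graph n → Family n m → Set
NonPiercing G ℋ = ∀ i j → Connected (Graph.Adj G) (λ v → v ∈ ℋ i × v ∉ ℋ j)

DualSupport : {n m : ℕ} → Graph n → Family n m → Graph m → Set
DualSupport G ℋ Q = ∀ v → Connected (Graph.Adj Q) (λ i → v ∈ ℋ i)

{-# OPTIONS --safe #-}
-- Root the tree of a decomposition of G and discard hyperedges contained in others.  At a node p,
-- restrict hyperedges to the vertices V p occurring in the subtree of p, consider those with
-- maximal restriction that meet the bag B p, and choose one representative for each trace on B p,
-- preferring representatives of the parent; there are at most 2^(t+1).  If h ∖ r avoids B p,
-- non-piercing puts it entirely inside or entirely outside V p.  Hence each h is contained in a
-- representative r inside V p, or agrees with one outside V p and on B p.  It follows that
-- the nodes represented by a fixed hyperedge form a subtree, that representatives containing a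
-- vertex v can be followed along the tree without losing v, and that every hyperedge h is covered
-- by the representatives at some node and its parent.  The bags consisting of the representatives
-- at a node and at its parent, together with a leaf bag adding h to the bag covering it, form a
-- tree decomposition; two hyperedges are adjacent in the support when they share a bag.
module Submission where

open import Defs
open import Data.Empty using (⊥-elim)
open import Data.Fin using (Fin; _↑ˡ_; _↑ʳ_; splitAt)
open import Data.Fin.Properties using (_≟_; any?; all?; splitAt-↑ˡ; splitAt-↑ʳ; splitAt⁻¹-↑ˡ; splitAt⁻¹-↑ʳ)
import Data.Fin as Fin
import Data.Fin.Properties as Fin
open import Data.Fin.Subset using (Subset; inside; outside; _∈_; _∉_; _⊆_; ∣_∣; _∩_; _∪_; ⊥; ⁅_⁆)
open import Data.Fin.Subset.Properties using (_∈?_; _⊆?_; ⊆-antisym; ∉⊥; x∈⁅x⁆; x∈⁅y⁆⇒x≡y; ∣⁅x⁆∣≡1; ∣⊥∣≡0; x∈p∩q⁺; x∈p∩q⁻; x∈p∪q⁺; x∈p∪q⁻)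
open import Data.List using (List; []; _∷_; _++_; map; mapMaybe; find; length; allFin)
open import Data.List.Membership.Propositional using () renaming (_∈_ to _∈ˡ_)
open import Data.List.Membership.Propositional.Properties using (∈-allFin; ∈-++⁺ˡ; ∈-++⁺ʳ; ∈-++⁻; ∈-map⁺)
open import Data.List.Properties using (length-map; length-++; length-mapMaybe)
open import Data.List.Relation.Unary.Any using (here; there)
import Data.List.Relation.Unary.Any as Any
open import Data.Maybe using (Maybe; just; nothing)
open import Data.Maybe.Properties using (just-injective)
open import Data.Nat using (ℕ; zero; suc; _+_; _*_; _^_; _≤_; _<_; z≤n; s≤s)
import Data.Nat.Properties as ℕ
open import Data.Product using (Σ; ∃; _×_; _,_; proj₁; proj₂)
open import Data.Sum using (_⊎_; inj₁; inj₂; [_,_]′; swap)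
open import Data.Unit using (tt)
open import Data.Vec using ([]; _∷_)
import Data.Vec.Properties as Vec
import Data.Bool.Properties as Bool
open import Function using (_∘_; id)
open import Relation.Binary.PropositionalEquality using (_≡_; _≢_; refl; sym; trans; cong; cong₂; subst)
open import Relation.Nullary using (¬_; Dec; yes; no; contradiction; decidable-stable)
open import Relation.Nullary.Decidable using (_×-dec_; _→-dec_; _⊎-dec_; ¬?; map′)

-- Walks

module _ {n : ℕ} {R : Fin n → Fin n → Set} {P : Fin n → Set} where

  walk-head : ∀ {u v} → Walk R P u v → P u
  walk-head (here p)     = p
  walk-head (step p _ _) = p

  infixr 5 _◅◅_
  _◅◅_ : ∀ {u v w} → Walk R P u v → Walk R P v w → Walk R P u w
  here _     ◅◅ q = q
  step p r s ◅◅ q = step p r (s ◅◅ q)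

  walk-reverse : (∀ {a b} → R a b → R b a) → ∀ {u v} → Walk R P u v → Walk R P v u
  walk-reverse R-sym (here p)     = here p
  walk-reverse R-sym (step p r s) =
    walk-reverse R-sym s ◅◅ step (walk-head s) (R-sym r) (here p)

  walk-map : ∀ {R′ : Fin n → Fin n → Set} → (∀ {a b} → R a b → R′ a b) →
             ∀ {u v} → Walk R P u v → Walk R′ P u v
  walk-map f (here p)     = here p
  walk-map f (step p r s) = step p (f r) (walk-map f s)

  walk-preserves : (X : Fin n → Set) → (∀ {a b} → P a → P b → R a b → X a → X b) →
                   ∀ {u v} → Walk R P u v → X u → X v
  walk-preserves X f (here p)     x = x
  walk-preserves X f (step p r s) x = walk-preserves X f s (f p (walk-head s) r x)

-- Maximal elements of finite preorders

module _ {N : ℕ} {P : Fin N → Set} {_≲_ : Fin N → Fin N → Set}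
         (P? : ∀ i → Dec (P i)) (_≲?_ : ∀ i j → Dec (i ≲ j))
         (≲-refl : ∀ {i} → i ≲ i) (≲-trans : ∀ {i j k} → i ≲ j → j ≲ k → i ≲ k) where

  private
    -- An element above the current candidate replaces it, and by transitivity the comparisons
    -- already settled stay settled.
    maximal-in : (xs : List (Fin N)) → ∀ i → P i →
                 ∃ λ j → P j × i ≲ j × (∀ {k} → k ∈ˡ xs → P k → j ≲ k → k ≲ j)
    maximal-in []       i p = i , p , ≲-refl , λ ()
    maximal-in (x ∷ xs) i p with maximal-in xs i p
    ... | j , pj , i≲j , max with P? x ×-dec (j ≲? x)
    ... | yes (px , j≲x) = x , px , ≲-trans i≲j j≲x ,
          λ { (here refl) _ q → q
            ; (there k∈) pk q → ≲-trans (max k∈ pk (≲-trans j≲x q)) j≲x }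
    ... | no ¬px = j , pj , i≲j ,
          λ { (here refl) pk q → contradiction (pk , q) ¬px
            ; (there k∈) → max k∈ }

  opaque
    maximal-above : ∀ i → P i → ∃ λ j → P j × i ≲ j × (∀ k → P k → j ≲ k → k ≲ j)
    maximal-above i p with maximal-in (allFin N) i p
    ... | j , pj , i≲j , max = j , pj , i≲j , λ k → max (∈-allFin k)

-- Searching lists and counting subsets

module _ {A : Set} {P : A → Set} (P? : ∀ x → Dec (P x)) where

  find-sound : ∀ xs {x} → find P? xs ≡ just x → P x
  find-sound (y ∷ ys) eq with P? y
  find-sound (y ∷ ys) refl | yes p = p
  find-sound (y ∷ ys) eq   | no _  = find-sound ys eq

  find-prefix : ∀ xs ys {x} → x ∈ˡ xs → P x → ∃ λ y → find P? (xs ++ ys) ≡ just y × y ∈ˡ xs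
  find-prefix (z ∷ zs) ys x∈ p with P? z
  ... | yes _ = z , refl , here refl
  find-prefix (z ∷ zs) ys (here refl) p | no ¬p = contradiction p ¬p
  find-prefix (z ∷ zs) ys (there x∈)  p | no _  with find-prefix zs ys x∈ p
  ... | y , eq , y∈ = y , eq , there y∈

  find-complete : ∀ xs {x} → x ∈ˡ xs → P x → ∃ λ y → find P? xs ≡ just y
  find-complete (z ∷ zs) x∈ p with P? z
  ... | yes _ = z , refl
  find-complete (z ∷ zs) (here refl) p | no ¬p = contradiction p ¬p
  find-complete (z ∷ zs) (there x∈)  p | no _  = find-complete zs x∈ p

module _ {A B : Set} (f : A → Maybe B) where

  ∈-mapMaybe⁺ : ∀ xs {x y} → x ∈ˡ xs → f x ≡ just y → y ∈ˡ mapMaybe f xs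
  ∈-mapMaybe⁺ (z ∷ zs) (here refl) eq with f z
  ∈-mapMaybe⁺ (z ∷ zs) (here refl) refl | just _ = here refl
  ∈-mapMaybe⁺ (z ∷ zs) (there x∈)  eq with f z
  ... | just _  = there (∈-mapMaybe⁺ zs x∈ eq)
  ... | nothing = ∈-mapMaybe⁺ zs x∈ eq

  ∈-mapMaybe⁻ : ∀ xs {y} → y ∈ˡ mapMaybe f xs → ∃ λ x → f x ≡ just y
  ∈-mapMaybe⁻ (z ∷ zs) y∈ with f z in eq
  ∈-mapMaybe⁻ (z ∷ zs) (here refl) | just _  = z , eq
  ∈-mapMaybe⁻ (z ∷ zs) (there y∈)  | just _  = ∈-mapMaybe⁻ zs y∈
  ∈-mapMaybe⁻ (z ∷ zs) y∈          | nothing = ∈-mapMaybe⁻ zs y∈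

subsetsOf : ∀ {n} → Subset n → List (Subset n)
subsetsOf []            = [] ∷ []
subsetsOf (outside ∷ p) = map (outside ∷_) (subsetsOf p)
subsetsOf (inside ∷ p)  = map (outside ∷_) (subsetsOf p) ++ map (inside ∷_) (subsetsOf p)

∈-subsetsOf : ∀ {n} (q p : Subset n) → (q ∩ p) ∈ˡ subsetsOf p
∈-subsetsOf []            []            = here refl
∈-subsetsOf (outside ∷ q) (outside ∷ p) = ∈-map⁺ (outside ∷_) (∈-subsetsOf q p)
∈-subsetsOf (inside ∷ q)  (outside ∷ p) = ∈-map⁺ (outside ∷_) (∈-subsetsOf q p)
∈-subsetsOf (outside ∷ q) (inside ∷ p)  = ∈-++⁺ˡ (∈-map⁺ (outside ∷_) (∈-subsetsOf q p))
∈-subsetsOf (inside ∷ q)  (inside ∷ p)  = ∈-++⁺ʳ _ (∈-map⁺ (inside ∷_) (∈-subsetsOf q p))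

length-subsetsOf : ∀ {n} (p : Subset n) → length (subsetsOf p) ≡ 2 ^ ∣ p ∣
length-subsetsOf []            = refl
length-subsetsOf (outside ∷ p) = trans (length-map _ (subsetsOf p)) (length-subsetsOf p)
length-subsetsOf (inside ∷ p)  =
  trans (length-++ (map (outside ∷_) (subsetsOf p)))
        (cong₂ _+_ (trans (length-map _ (subsetsOf p)) (length-subsetsOf p))
                   (trans (length-map _ (subsetsOf p))
                          (trans (length-subsetsOf p) (sym (ℕ.+-identityʳ _)))))

∣p∪q∣≤∣p∣+∣q∣ : ∀ {n} (p q : Subset n) → ∣ p ∪ q ∣ ≤ ∣ p ∣ + ∣ q ∣
∣p∪q∣≤∣p∣+∣q∣ []            []            = z≤n
∣p∪q∣≤∣p∣+∣q∣ (outside ∷ p) (outside ∷ q) = ∣p∪q∣≤∣p∣+∣q∣ p q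
∣p∪q∣≤∣p∣+∣q∣ (outside ∷ p) (inside ∷ q)  =
  ℕ.≤-trans (s≤s (∣p∪q∣≤∣p∣+∣q∣ p q)) (ℕ.≤-reflexive (sym (ℕ.+-suc ∣ p ∣ ∣ q ∣)))
∣p∪q∣≤∣p∣+∣q∣ (inside ∷ p)  (outside ∷ q) = s≤s (∣p∪q∣≤∣p∣+∣q∣ p q)
∣p∪q∣≤∣p∣+∣q∣ (inside ∷ p)  (inside ∷ q)  =
  s≤s (ℕ.≤-trans (∣p∪q∣≤∣p∣+∣q∣ p q) (ℕ.+-monoʳ-≤ ∣ p ∣ (ℕ.n≤1+n ∣ q ∣)))

∣⁅x⁆∪p∣≤1+∣p∣ : ∀ {n} (x : Fin n) (p : Subset n) → ∣ ⁅ x ⁆ ∪ p ∣ ≤ suc ∣ p ∣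
∣⁅x⁆∪p∣≤1+∣p∣ x p =
  subst (λ k → ∣ ⁅ x ⁆ ∪ p ∣ ≤ k + ∣ p ∣) (∣⁅x⁆∣≡1 x) (∣p∪q∣≤∣p∣+∣q∣ ⁅ x ⁆ p)

fromList : ∀ {n} → List (Fin n) → Subset n
fromList []       = ⊥
fromList (x ∷ xs) = ⁅ x ⁆ ∪ fromList xs

∈-fromList⁺ : ∀ {n} {x : Fin n} {xs} → x ∈ˡ xs → x ∈ fromList xs
∈-fromList⁺ {x = x} (here refl) = x∈p∪q⁺ (inj₁ (x∈⁅x⁆ x))
∈-fromList⁺ (there x∈)          = x∈p∪q⁺ (inj₂ (∈-fromList⁺ x∈))

∈-fromList⁻ : ∀ {n} {x : Fin n} xs → x ∈ fromList xs → x ∈ˡ xs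
∈-fromList⁻ []       x∈ = contradiction x∈ ∉⊥
∈-fromList⁻ (y ∷ ys) x∈ with x∈p∪q⁻ ⁅ y ⁆ (fromList ys) x∈
... | inj₁ x∈y  = here (x∈⁅y⁆⇒x≡y y x∈y)
... | inj₂ x∈ys = there (∈-fromList⁻ ys x∈ys)

∣fromList∣≤length : ∀ {n} (xs : List (Fin n)) → ∣ fromList xs ∣ ≤ length xs
∣fromList∣≤length {n} []   = ℕ.≤-reflexive (∣⊥∣≡0 n)
∣fromList∣≤length (x ∷ xs) =
  ℕ.≤-trans (∣⁅x⁆∪p∣≤1+∣p∣ x (fromList xs)) (s≤s (∣fromList∣≤length xs))

-- Rooted trees

record Rooted (N : ℕ) : Set where
  field
    root     : Fin N
    par      : Fin N → Fin N
    dep      : Fin N → ℕ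
    par-root : par root ≡ root
    dep-par  : ∀ {i} → i ≢ root → dep i ≡ suc (dep (par i))

  Edge : Fin N → Fin N → Set
  Edge i j = (i ≢ root × par i ≡ j) ⊎ (j ≢ root × par j ≡ i)

  infix 4 _≼_ _≼?_
  data _≼_ (a : Fin N) : Fin N → Set where
    ≼-refl : a ≼ a
    below  : ∀ {j} → j ≢ root → a ≼ par j → a ≼ j

  dep-< : ∀ {i} → i ≢ root → dep (par i) < dep i
  dep-< i≢ = ℕ.≤-reflexive (sym (dep-par i≢))

  -- Induction from the root downwards. It runs on a bound for the depth because `par` is not
  -- structurally decreasing.
  tree-rec : (X : Fin N → Set) → (∀ i → (i ≢ root → X (par i)) → X i) → ∀ i → X i
  tree-rec X f i = go (dep i) i ℕ.≤-refl
    where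
    go : ∀ k i → dep i ≤ k → X i
    go zero    i d = f i λ i≢ → contradiction (ℕ.≤-trans (dep-< i≢) d) λ ()
    go (suc k) i d = f i λ i≢ → go k (par i) (ℕ.≤-pred (ℕ.≤-trans (dep-< i≢) d))

  ≼-trans : ∀ {a b c} → a ≼ b → b ≼ c → a ≼ c
  ≼-trans p ≼-refl      = p
  ≼-trans p (below c q) = below c (≼-trans p q)

  ≼-dep : ∀ {a b} → a ≼ b → dep a ≤ dep b
  ≼-dep ≼-refl       = ℕ.≤-refl
  ≼-dep (below b≢ p) = ℕ.≤-trans (≼-dep p) (ℕ.<⇒≤ (dep-< b≢))

  ≼-antisym : ∀ {a b} → a ≼ b → b ≼ a → a ≡ b
  ≼-antisym ≼-refl       q = refl
  ≼-antisym (below b≢ p) q =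
    contradiction (ℕ.≤-trans (dep-< b≢) (ℕ.≤-trans (≼-dep q) (≼-dep p))) (ℕ.<-irrefl refl)

  par⋡ : ∀ {i} → i ≢ root → ¬ i ≼ par i
  par⋡ i≢ q = contradiction (ℕ.≤-trans (dep-< i≢) (≼-dep q)) (ℕ.<-irrefl refl)

  par≼ : ∀ {i} → i ≢ root → par i ≼ i
  par≼ i≢ = below i≢ ≼-refl

  root≼ : ∀ i → root ≼ i
  root≼ = tree-rec (root ≼_) λ i ih → go i ih
    where
    go : ∀ i → (i ≢ root → root ≼ par i) → root ≼ i
    go i ih with i ≟ root
    ... | yes refl = ≼-refl
    ... | no i≢    = below i≢ (ih i≢)

  ≼-up : ∀ {a j} → a ≼ j → a ≢ j → j ≢ root × a ≼ par j
  ≼-up ≼-refl       a≢ = contradiction refl a≢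
  ≼-up (below j≢ p) a≢ = j≢ , p

  opaque
    _≼?_ : ∀ a j → Dec (a ≼ j)
    a ≼? j = tree-rec (λ j → Dec (a ≼ j)) go j
      where
      go : ∀ j → (j ≢ root → Dec (a ≼ par j)) → Dec (a ≼ j)
      go j ih with a ≟ j
      ... | yes refl = yes ≼-refl
      ... | no a≢j with j ≟ root
      ... | yes j≡ = no λ p → proj₁ (≼-up p a≢j) j≡
      ... | no j≢  = map′ (below j≢) (λ p → proj₂ (≼-up p a≢j)) (ih j≢)

  ≼-comparable : ∀ {a b i} → a ≼ i → b ≼ i → a ≼ b ⊎ b ≼ a
  ≼-comparable ≼-refl      q           = inj₂ q
  ≼-comparable p           ≼-refl      = inj₁ p
  ≼-comparable (below _ p) (below _ q) = ≼-comparable p q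

  child-towards : ∀ {q i} → q ≼ i → q ≢ i → ∃ λ c → c ≢ root × par c ≡ q × c ≼ i
  child-towards ≼-refl q≢i = contradiction refl q≢i
  child-towards {q} {i} (below i≢ p) _ with q ≟ par i
  ... | yes q≡ = i , i≢ , sym q≡ , ≼-refl
  ... | no q≢ with child-towards p q≢
  ... | c , c≢ , eq , c≼ = c , c≢ , eq , below i≢ c≼

  Edge-sym : ∀ {i j} → Edge i j → Edge j i
  Edge-sym = swap

  toGraph : Graph N
  toGraph = record
    { Adj    = Edge
    ; sym    = Edge-sym
    ; irrefl = [ no-loop , no-loop ]′
    }
    where
    no-loop : ∀ {u} → ¬ (u ≢ root × par u ≡ u)
    no-loop {u} (u≢ , eq) = par⋡ u≢ (subst (u ≼_) (sym eq) ≼-refl)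

  -- Passing to parents must stop, and it can stop only at `t`, where any two ascents meet.
  -- Coherence of bags is thereby reduced to comparing a node with its parent.
  connected-from-top : ∀ {P : Fin N → Set} t → (∀ i → P i → i ≢ t → i ≢ root × P (par i)) →
                       Connected Edge P
  connected-from-top {P} t climb u v pu pv =
    to-top u pu ◅◅ walk-reverse Edge-sym (to-top v pv)
    where
    to-top : ∀ i → P i → Walk Edge P i t
    to-top = tree-rec (λ i → P i → Walk Edge P i t) go
      where
      go : ∀ i → (i ≢ root → P (par i) → Walk Edge P (par i) t) → P i → Walk Edge P i t
      go i ih pi with i ≟ t
      ... | yes refl = here pi
      ... | no i≢t   with climb i pi i≢t
      ... | i≢root , pp = step pi (inj₁ (i≢root , refl)) (ih i≢root pp)

  -- The edge from `a` to its parent is the only way out of the subtree of `a`. Acyclicity follows.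
  subtree-closed : ∀ {a x y} → Edge x y → a ≼ x → ¬ (x ≡ a × y ≡ par a) → a ≼ y
  subtree-closed (inj₁ (x≢ , refl)) ≼-refl      ¬e = contradiction (refl , refl) ¬e
  subtree-closed (inj₁ (x≢ , refl)) (below _ p) ¬e = p
  subtree-closed (inj₂ (y≢ , refl)) p           ¬e = below y≢ p

  toGraph-isTree : IsTree toGraph
  toGraph-isTree = record
    { nonempty  = root
    ; connected = connected-from-top root λ i _ i≢ → i≢ , tt
    ; acyclic   = acyclic
    }
    where
    acyclic : ∀ a b → Edge a b → ¬ Walk (RemoveEdge Edge a b) AllVertices a b
    acyclic a b (inj₁ (a≢ , refl)) w =
      par⋡ a≢ (walk-preserves (a ≼_)
        (λ _ _ (e , ¬e) a≼ → subtree-closed e a≼ λ xy → ¬e (inj₁ xy)) w ≼-refl)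
    acyclic a b (inj₂ (b≢ , refl)) w =
      par⋡ b≢ (walk-preserves (b ≼_)
        (λ _ _ (e , ¬e) b≼ → subtree-closed e b≼ λ xy → ¬e (inj₂ xy))
        (walk-reverse (λ (e , ¬e) → Edge-sym e ,
          λ { (inj₁ (p , q)) → ¬e (inj₂ (q , p)) ; (inj₂ (p , q)) → ¬e (inj₁ (q , p)) }) w) ≼-refl)

-- Attaching one leaf per hyperedge

module _ {N m : ℕ} (tree : Rooted N) (att : Fin m → Fin N) where

  open Rooted tree

  leaf-cases : (P : Fin (N + m) → Set) → (∀ i → P (i ↑ˡ m)) → (∀ h → P (N ↑ʳ h)) → ∀ x → P x
  leaf-cases P f g x with splitAt N x in eq
  ... | inj₁ i = subst P (splitAt⁻¹-↑ˡ eq) (f i)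
  ... | inj₂ h = subst P (splitAt⁻¹-↑ʳ {N} eq) (g h)

  onNodes : {A : Set} → (Fin N → A) → (Fin m → A) → Fin (N + m) → A
  onNodes f g = [ f , g ]′ ∘ splitAt N

  onNodes-node : ∀ {A : Set} {f : Fin N → A} {g} i → onNodes f g (i ↑ˡ m) ≡ f i
  onNodes-node i = cong [ _ , _ ]′ (splitAt-↑ˡ N i m)

  onNodes-leaf : ∀ {A : Set} {f : Fin N → A} {g} h → onNodes f g (N ↑ʳ h) ≡ g h
  onNodes-leaf h = cong [ _ , _ ]′ (splitAt-↑ʳ N m h)

  leaf≢node : ∀ {h i} → N ↑ʳ h ≢ i ↑ˡ m
  leaf≢node {h} {i} eq
    with trans (sym (splitAt-↑ʳ N m h)) (trans (cong (splitAt N) eq) (splitAt-↑ˡ N i m))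
  ... | ()

  attachLeaves : Rooted (N + m)
  attachLeaves = record
    { root     = root ↑ˡ m
    ; par      = par′
    ; dep      = dep′
    ; par-root = trans (onNodes-node root) (cong (_↑ˡ m) par-root)
    ; dep-par  = λ {x} → dep-par′ x
    }
    where
    par′ : Fin (N + m) → Fin (N + m)
    par′ = onNodes (λ i → par i ↑ˡ m) (λ h → att h ↑ˡ m)

    dep′ : Fin (N + m) → ℕ
    dep′ = onNodes dep (λ h → suc (dep (att h)))

    dep-par′ : ∀ x → x ≢ root ↑ˡ m → dep′ x ≡ suc (dep′ (par′ x))
    dep-par′ = leaf-cases _
      (λ i i≢ → trans (onNodes-node i) (trans (dep-par (i≢ ∘ cong (_↑ˡ m)))
         (cong suc (sym (trans (cong dep′ (onNodes-node i)) (onNodes-node (par i)))))))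
      (λ h _ → trans (onNodes-leaf h)
         (cong suc (sym (trans (cong dep′ (onNodes-leaf h)) (onNodes-node (att h))))))

-- Rooting a tree

module _ {N : ℕ} {T : Graph N} (isTree : IsTree T) where

  open Graph T using (Adj)

  private
    r₀ : Fin N
    r₀ = IsTree.nonempty isTree

    -- Parent pointers on a growing vertex set `dom`; outside it the values of `par` and `dep` are
    -- arbitrary.
    record PartialRooting : Set where
      field
        dom      : Subset N
        par      : Fin N → Fin N
        dep      : Fin N → ℕ
        root∈    : r₀ ∈ dom
        par-root : par r₀ ≡ r₀
        par∈     : ∀ {i} → i ∈ dom → i ≢ r₀ → par i ∈ dom
        adj      : ∀ {i} → i ∈ dom → i ≢ r₀ → Adj i (par i)
        dep-par  : ∀ {i} → i ∈ dom → i ≢ r₀ → dep i ≡ suc (dep (par i))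

    open PartialRooting using (dom)

    extend : (S : PartialRooting) → ∀ {u w} → w ∈ dom S → u ∉ dom S → Adj u w →
             ∃ λ S′ → dom S ⊆ dom S′ × u ∈ dom S′
    extend S {u} {w} w∈ u∉ u~w = S′ , x∈p∪q⁺ ∘ inj₂ , x∈p∪q⁺ (inj₁ (x∈⁅x⁆ u))
      where
      open PartialRooting S renaming (dom to D)

      new : {A : Set} → A → (Fin N → A) → Fin N → A
      new a f i with i ≟ u
      ... | yes _ = a
      ... | no _  = f i

      new-old : ∀ {A : Set} {a : A} {f i} → i ∈ D → new a f i ≡ f i
      new-old {i = i} i∈ with i ≟ u
      ... | yes refl = contradiction i∈ u∉
      ... | no _     = refl

      new-new : ∀ {A : Set} {a : A} {f} → new a f u ≡ a
      new-new with u ≟ u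
      ... | yes _ = refl
      ... | no u≢ = contradiction refl u≢

      par′ : Fin N → Fin N
      par′ = new w par

      dep′ : Fin N → ℕ
      dep′ = new (suc (dep w)) dep

      old-or-new : ∀ {i} → i ∈ ⁅ u ⁆ ∪ D → i ≡ u ⊎ i ∈ D
      old-or-new i∈ = [ inj₁ ∘ x∈⁅y⁆⇒x≡y u , inj₂ ]′ (x∈p∪q⁻ ⁅ u ⁆ D i∈)

      S′ : PartialRooting
      S′ = record
        { dom      = ⁅ u ⁆ ∪ D
        ; par      = par′
        ; dep      = dep′
        ; root∈    = x∈p∪q⁺ (inj₂ root∈)
        ; par-root = trans (new-old root∈) par-root
        ; par∈     = λ i∈ i≢ → x∈p∪q⁺ (inj₂ (par′∈ (old-or-new i∈) i≢))
        ; adj      = λ i∈ → adj′ (old-or-new i∈)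
        ; dep-par  = λ i∈ → dep-par′ (old-or-new i∈)
        }
        where
        par′∈ : ∀ {i} → i ≡ u ⊎ i ∈ D → i ≢ r₀ → par′ i ∈ D
        par′∈ (inj₁ refl) _  = subst (_∈ D) (sym new-new) w∈
        par′∈ (inj₂ i∈)   i≢ = subst (_∈ D) (sym (new-old i∈)) (par∈ i∈ i≢)

        adj′ : ∀ {i} → i ≡ u ⊎ i ∈ D → i ≢ r₀ → Adj i (par′ i)
        adj′ (inj₁ refl) _      = subst (Adj u) (sym new-new) u~w
        adj′ {i} (inj₂ i∈) i≢ = subst (Adj i) (sym (new-old i∈)) (adj i∈ i≢)

        dep-par′ : ∀ {i} → i ≡ u ⊎ i ∈ D → i ≢ r₀ → dep′ i ≡ suc (dep′ (par′ i))
        dep-par′ (inj₁ refl) _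
          rewrite new-new {a = w} {par} | new-new {a = suc (dep w)} {dep}
                | new-old {a = suc (dep w)} {dep} w∈ = refl
        dep-par′ (inj₂ i∈) i≢
          rewrite new-old {a = w} {par} i∈ | new-old {a = suc (dep w)} {dep} i∈
                | new-old {a = suc (dep w)} {dep} (par∈ i∈ i≢) = dep-par i∈ i≢

    -- The walk is absorbed from its end at the root, each new vertex taking its successor on the
    -- walk as parent.
    absorb : ∀ {u} → Walk Adj AllVertices u r₀ → (S : PartialRooting) →
             ∃ λ S′ → dom S ⊆ dom S′ × u ∈ dom S′
    absorb (here _) S = S , id , PartialRooting.root∈ S
    absorb (step {u} _ u~w rest) S with absorb rest S
    ... | S₁ , S⊆S₁ , w∈ with u ∈? dom S₁
    ... | yes u∈ = S₁ , S⊆S₁ , u∈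
    ... | no u∉  with extend S₁ w∈ u∉ u~w
    ... | S₂ , S₁⊆S₂ , u∈ = S₂ , S₁⊆S₂ ∘ S⊆S₁ , u∈

    absorb-all : (xs : List (Fin N)) (S : PartialRooting) →
                 ∃ λ S′ → dom S ⊆ dom S′ × (∀ {i} → i ∈ˡ xs → i ∈ dom S′)
    absorb-all []       S = S , id , λ ()
    absorb-all (x ∷ xs) S with absorb (IsTree.connected isTree x r₀ tt tt) S
    ... | S₁ , S⊆S₁ , x∈ with absorb-all xs S₁
    ... | S₂ , S₁⊆S₂ , xs∈ = S₂ , S₁⊆S₂ ∘ S⊆S₁ , λ { (here refl) → S₁⊆S₂ x∈ ; (there i∈) → xs∈ i∈ }

    initial : PartialRooting
    initial = record
      { dom      = ⁅ r₀ ⁆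
      ; par      = λ _ → r₀
      ; dep      = λ _ → 0
      ; root∈    = x∈⁅x⁆ r₀
      ; par-root = refl
      ; par∈     = λ _ _ → x∈⁅x⁆ r₀
      ; adj      = λ i∈ i≢ → contradiction (x∈⁅y⁆⇒x≡y r₀ i∈) i≢
      ; dep-par  = λ i∈ i≢ → contradiction (x∈⁅y⁆⇒x≡y r₀ i∈) i≢
      }

  -- The inclusion of edges carries the coherence walks of the given decomposition over to the
  -- rooted tree.
  root-tree : Σ (Rooted N) λ R → ∀ {i j} → Adj i j → Rooted.Edge R i j
  root-tree with absorb-all (allFin N) initial
  ... | S , _ , all∈ = R , λ {i} {j} → edge i j
    where
    open PartialRooting S using (adj; dep-par)

    R : Rooted N
    R = record
      { root     = r₀
      ; par      = PartialRooting.par S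
      ; dep      = PartialRooting.dep S
      ; par-root = PartialRooting.par-root S
      ; dep-par  = λ {i} → dep-par (all∈ (∈-allFin i))
      }
    open Rooted R using (par; Edge; Edge-sym; toGraph-isTree)

    Edge⇒Adj : ∀ {i j} → Edge i j → Adj i j
    Edge⇒Adj {i} (inj₁ (i≢ , refl))     = adj (all∈ (∈-allFin i)) i≢
    Edge⇒Adj {j = j} (inj₂ (j≢ , refl)) = Graph.sym T (adj (all∈ (∈-allFin j)) j≢)

    Edge? : ∀ i j → Dec (Edge i j)
    Edge? i j = (¬? (i ≟ r₀) ×-dec (par i ≟ j)) ⊎-dec (¬? (j ≟ r₀) ×-dec (par j ≟ i))

    -- An edge of T outside the spanning tree of parent edges closes a cycle.
    edge : ∀ i j → Adj i j → Edge i j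
    edge i j i~j with Edge? i j
    ... | yes e = e
    ... | no ¬e = ⊥-elim (IsTree.acyclic isTree i j i~j
                    (walk-map keep (IsTree.connected toGraph-isTree i j tt tt)))
      where
      keep : ∀ {a b} → Edge a b → RemoveEdge Adj i j a b
      keep e = Edge⇒Adj e , λ { (inj₁ (refl , refl)) → ¬e e
                              ; (inj₂ (refl , refl)) → ¬e (Edge-sym e) }

-- Representatives of the hyperedges

module Construction
  {n m N : ℕ} (G : Graph n) (ℋ : Family n m)
  (ℋ-connected : ConnectedFamily G ℋ) (ℋ-nonPiercing : NonPiercing G ℋ)
  (tree : Rooted N) (B : Fin N → Subset n)
  (covV : ∀ v → ∃ λ i → v ∈ B i)
  (covE : ∀ u v → Graph.Adj G u v → ∃ λ i → u ∈ B i × v ∈ B i)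
  (coherent : ∀ v → Connected (Rooted.Edge tree) (λ i → v ∈ B i)) where

  open Graph G using (Adj)
  open Rooted tree

  -- Separation by bags

  V : Fin N → Fin n → Set
  V p v = ∃ λ i → p ≼ i × v ∈ B i

  opaque
    V? : ∀ p v → Dec (V p v)
    V? p v = any? λ i → (p ≼? i) ×-dec (v ∈? B i)

  B⊆V : ∀ {p v} → v ∈ B p → V p v
  B⊆V {p} v∈ = p , ≼-refl , v∈

  V-mono : ∀ {p q v} → p ≼ q → V q v → V p v
  V-mono p≼q (i , q≼i , v∈) = i , ≼-trans p≼q q≼i , v∈

  opaque
    -- The walk through the bags containing `v` leaves the subtree of `q`, necessarily along the
    -- edge from `q` to its parent, so both ends of that edge have `v` in their bags.
    exit : ∀ {q i v} → V q v → v ∈ B i → ¬ q ≼ i → v ∈ B q × q ≢ root × v ∈ B (par q)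
    exit {q} {i} {v} (j , q≼j , v∈j) v∈i q⋠i = go (coherent v j i v∈j v∈i) q≼j
      where
      go : ∀ {a} → Walk Edge (λ i → v ∈ B i) a i → q ≼ a → v ∈ B q × q ≢ root × v ∈ B (par q)
      go (here _) q≼a = contradiction q≼a q⋠i
      go (step {w = w} pa e rest) q≼a with q ≼? w
      ... | yes q≼w = go rest q≼w
      go (step pa (inj₁ (a≢ , refl)) rest) ≼-refl      | no q⋠w = pa , a≢ , walk-head rest
      go (step pa (inj₁ (a≢ , refl)) rest) (below _ p) | no q⋠w = contradiction p q⋠w
      go (step pa (inj₂ (w≢ , refl)) rest) q≼a         | no q⋠w = contradiction (below w≢ q≼a) q⋠w

  -- An edge of `G` that starts in `V p` and lies in a bag outside the subtree of `p` starts in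
  -- `B p`, by `exit`. A connected set avoiding `B p` therefore cannot leave `V p`.
  confine : ∀ {X : Fin n → Set} p → Connected Adj X → (∀ {v} → X v → v ∉ B p) →
            ∀ {u v} → X u → V p u → X v → V p v
  confine {X} p conn avoid {u} {v} xu Vu xv = walk-preserves (V p) stay (conn u v xu xv) Vu
    where
    stay : ∀ {a b} → X a → X b → Adj a b → V p a → V p b
    stay {a} {b} xa _ a~b Va with covE a b a~b
    ... | i , a∈ , b∈ with p ≼? i
    ... | yes p≼i = i , p≼i , b∈
    ... | no p⋠i  = contradiction (proj₁ (exit Va a∈ p⋠i)) (avoid xa)

  -- `exit` puts the start of such an edge in the parent's bag as well. So a connected set avoiding
  -- the bag of a node is confined to a single child.
  confine-par : ∀ {X : Fin n → Set} c → Connected Adj X → (∀ {v} → X v → v ∉ B (par c)) →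
                ∀ {u v} → X u → V c u → X v → V c v
  confine-par {X} c conn avoid {u} {v} xu Vu xv = walk-preserves (V c) stay (conn u v xu xv) Vu
    where
    stay : ∀ {a b} → X a → X b → Adj a b → V c a → V c b
    stay {a} {b} xa _ a~b Va with covE a b a~b
    ... | i , a∈ , b∈ with c ≼? i
    ... | yes c≼i = i , c≼i , b∈
    ... | no c⋠i  = contradiction (proj₂ (proj₂ (exit Va a∈ c⋠i))) (avoid xa)

  Meets : Fin N → Fin m → Set
  Meets p h = ∃ λ v → v ∈ ℋ h × v ∈ B p

  Meets? : ∀ p h → Dec (Meets p h)
  Meets? p h = any? λ v → (v ∈? ℋ h) ×-dec (v ∈? B p)

  avoids : ∀ {p h} → ¬ Meets p h → ∀ {v} → v ∈ ℋ h → v ∉ B p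
  avoids ¬meets {v} v∈h v∈B = ¬meets (v , v∈h , v∈B)

  opaque
    meets-par : ∀ {q h u v} → u ∈ ℋ h → V q u → v ∈ ℋ h → v ∈ B (par q) ⊎ ¬ V q v → Meets (par q) h
    meets-par {q} {h} {u} {v} u∈ Vu v∈ (inj₁ v∈B) = v , v∈ , v∈B
    meets-par {q} {h} {u} {v} u∈ Vu v∈ (inj₂ ¬Vv) with Meets? (par q) h
    ... | yes meets = meets
    ... | no ¬meets = contradiction (confine-par q (ℋ-connected h) (avoids ¬meets) u∈ Vu v∈) ¬Vv

  opaque
    -- If `h` missed `B c`, it would be confined to `V c`. Its vertex in the parent's bag would then
    -- occur both inside and outside the subtree of `c`, hence in `B c`.
    meets-child : ∀ {c h u} → c ≢ root → Meets (par c) h → u ∈ ℋ h → V c u → Meets c h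
    meets-child {c} {h} c≢ (w , w∈h , w∈B) u∈ Vu with Meets? c h
    ... | yes meets = meets
    ... | no ¬meets = contradiction
            (proj₁ (exit (confine c (ℋ-connected h) (avoids ¬meets) u∈ Vu w∈h) w∈B (par⋡ c≢)))
            (avoids ¬meets w∈h)

  -- Among equal hyperedges only the one of largest index is kept.
  Kept : Fin m → Set
  Kept h = ∀ h′ → ℋ h ⊆ ℋ h′ → ℋ h′ ⊆ ℋ h × h′ Fin.≤ h

  opaque
    Kept? : ∀ h → Dec (Kept h)
    Kept? h = all? λ h′ → (ℋ h ⊆? ℋ h′) →-dec ((ℋ h′ ⊆? ℋ h) ×-dec (h′ Fin.≤? h))

  opaque
    kept-antichain : ∀ {h h′} → Kept h → Kept h′ → ℋ h ⊆ ℋ h′ → h ≡ h′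
    kept-antichain {h} {h′} k k′ h⊆h′ with k h′ h⊆h′
    ... | h′⊆h , h′≤h = Fin.≤-antisym (proj₂ (k′ h h′⊆h)) h′≤h

  opaque
    keep : ∀ h → ∃ λ k → Kept k × ℋ h ⊆ ℋ k
    keep h
      with maximal-above {P = AllVertices} (λ _ → yes tt) (λ i j → ℋ i ⊆? ℋ j)
             id (λ p q → q ∘ p) h tt
    ... | h₁ , _ , h⊆h₁ , max₁
      -- By maximality of `h₁` the candidates are exactly its copies; this search returns the copy
      -- of largest index.
      with maximal-above {P = λ k → ℋ h₁ ⊆ ℋ k} (λ k → ℋ h₁ ⊆? ℋ k) Fin._≤?_ Fin.≤-refl Fin.≤-trans h₁ id
    ... | h₂ , h₁⊆h₂ , _ , max₂ = h₂ , kept , h₁⊆h₂ ∘ h⊆h₁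
      where
      kept : Kept h₂
      kept h′ h₂⊆h′ = h₁⊆h₂ ∘ max₁ h′ tt (h₂⊆h′ ∘ h₁⊆h₂) ,
        [ id , max₂ h′ (h₂⊆h′ ∘ h₁⊆h₂) ]′ (Fin.≤-total h′ h₂)

  -- Comparing hyperedges inside a subtree

  infix 4 _≤[_]_ _≈[_]_
  _≤[_]_ : Fin m → Fin N → Fin m → Set
  h ≤[ p ] h′ = ∀ v → V p v → v ∈ ℋ h → v ∈ ℋ h′

  opaque
    ≤[]? : ∀ h p h′ → Dec (h ≤[ p ] h′)
    ≤[]? h p h′ = all? λ v → V? p v →-dec ((v ∈? ℋ h) →-dec (v ∈? ℋ h′))

  ≤[]-trans : ∀ {p h h′ h″} → h ≤[ p ] h′ → h′ ≤[ p ] h″ → h ≤[ p ] h″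
  ≤[]-trans f g v Vv v∈ = g v Vv (f v Vv v∈)

  ≤[]-mono : ∀ {p q h h′} → p ≼ q → h ≤[ p ] h′ → h ≤[ q ] h′
  ≤[]-mono p≼q f v Vv = f v (V-mono p≼q Vv)

  opaque
    ≰[]-witness : ∀ {h p h′} → ¬ h ≤[ p ] h′ → ∃ λ v → V p v × v ∈ ℋ h × v ∉ ℋ h′
    ≰[]-witness {h} {p} {h′} ¬f with any? (λ v → V? p v ×-dec ((v ∈? ℋ h) ×-dec ¬? (v ∈? ℋ h′)))
    ... | yes w = w
    ... | no ¬w = contradiction
            (λ v Vv v∈ → decidable-stable (v ∈? ℋ h′) λ v∉ → ¬w (v , Vv , v∈ , v∉)) ¬f

  _≈[_]_ : Fin m → Fin N → Fin m → Set
  h ≈[ p ] h′ = ℋ h ∩ B p ≡ ℋ h′ ∩ B p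

  ≈[]-to : ∀ {h p h′ v} → h ≈[ p ] h′ → v ∈ B p → v ∈ ℋ h → v ∈ ℋ h′
  ≈[]-to {h} {p} {h′} eq v∈B v∈h =
    proj₁ (x∈p∩q⁻ (ℋ h′) (B p) (subst (_ ∈_) eq (x∈p∩q⁺ (v∈h , v∈B))))

  ≈[]-from : ∀ {h p h′} → (∀ {v} → v ∈ B p → v ∈ ℋ h → v ∈ ℋ h′) →
             (∀ {v} → v ∈ B p → v ∈ ℋ h′ → v ∈ ℋ h) → h ≈[ p ] h′
  ≈[]-from {h} {p} {h′} f g = ⊆-antisym (half h h′ f) (half h′ h g)
    where
    half : ∀ a b → (∀ {v} → v ∈ B p → v ∈ ℋ a → v ∈ ℋ b) → ℋ a ∩ B p ⊆ ℋ b ∩ B p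
    half a b k v∈ with x∈p∩q⁻ (ℋ a) (B p) v∈
    ... | v∈a , v∈B = x∈p∩q⁺ (k v∈B v∈a , v∈B)

  ≤≥⇒≈ : ∀ {h p h′} → h ≤[ p ] h′ → h′ ≤[ p ] h → h ≈[ p ] h′
  ≤≥⇒≈ f g = ≈[]-from (λ v∈B → f _ (B⊆V v∈B)) (λ v∈B → g _ (B⊆V v∈B))

  -- ℋ h ∖ ℋ h′ avoids the bag at p, so being connected it lies on one side of p.
  opaque
    difference-below : ∀ {p h h′} → (∀ {v} → v ∈ B p → v ∈ ℋ h → v ∈ ℋ h′) → ¬ h ≤[ p ] h′ →
                       ∀ {v} → v ∈ ℋ h → ¬ V p v → v ∈ ℋ h′
    difference-below {p} {h} {h′} f h≰h′ {v} v∈h ¬Vv with ≰[]-witness h≰h′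
    ... | u , Vu , u∈h , u∉h′ = decidable-stable (v ∈? ℋ h′) λ v∉h′ →
      ¬Vv (confine p (ℋ-nonPiercing h h′) (λ (x∈h , x∉h′) x∈B → x∉h′ (f x∈B x∈h))
                   (u∈h , u∉h′) Vu (v∈h , v∉h′))

  -- Choosing representatives

  Good : Fin N → Fin m → Set
  Good p h = Kept h × Meets p h × (∀ h′ → Kept h′ → h ≤[ p ] h′ → h′ ≤[ p ] h)

  Good? : ∀ p h → Dec (Good p h)
  Good? p h = Kept? h ×-dec (Meets? p h ×-dec
                (all? λ h′ → Kept? h′ →-dec (≤[]? h p h′ →-dec ≤[]? h′ p h)))

  opaque
    Good-resp : ∀ {p h h′} → Good p h → Kept h′ → h ≤[ p ] h′ → h′ ≤[ p ] h → Good p h′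
    Good-resp (_ , (u , u∈h , u∈B) , max) k′ f g =
      k′ , (u , f u (B⊆V u∈B) u∈h , u∈B) ,
      λ h″ k″ e → ≤[]-trans (max h″ k″ (≤[]-trans f e)) f

  opaque
    InClass? : ∀ p S h → Dec (Good p h × ℋ h ∩ B p ≡ S)
    InClass? p S h = Good? p h ×-dec Vec.≡-dec Bool._≟_ (ℋ h ∩ B p) S

  -- Searching prev, the representatives at the parent, first makes representatives persist
  -- downwards; this is what keeps the nodes of a fixed representative connected.
  pick : Fin N → List (Fin m) → Subset n → Maybe (Fin m)
  pick p prev S = find (InClass? p S) (prev ++ allFin m)

  select : Fin N → List (Fin m) → List (Fin m)
  select p prev = mapMaybe (pick p prev) (subsetsOf (B p))

  opaque
    -- The number counts steps towards the root. `reps` starts at the depth, so away from the root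
    -- the preferred list is exactly `reps (par p)`.
    repsAt : ℕ → Fin N → List (Fin m)
    repsAt zero    p = select p []
    repsAt (suc k) p = select p (repsAt k (par p))

    reps : Fin N → List (Fin m)
    reps p = repsAt (dep p) p

    reps-par : ∀ {p} → p ≢ root → reps p ≡ select p (reps (par p))
    reps-par p≢ rewrite dep-par p≢ = refl

    reps-select : ∀ p → ∃ λ prev → reps p ≡ select p prev
    reps-select p with dep p
    ... | zero  = [] , refl
    ... | suc k = repsAt k (par p) , refl

  Rep : Fin N → Fin m → Set
  Rep p h = h ∈ˡ reps p

  Rep? : ∀ p h → Dec (Rep p h)
  Rep? p h = Any.any? (h ≟_) (reps p)

  -- A search result has the trace searched for, so it also answers the query for its own trace.
  -- Representatives with equal traces therefore coincide.
  select-pick : ∀ {p prev h} → h ∈ˡ select p prev → pick p prev (ℋ h ∩ B p) ≡ just h × Good p h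
  select-pick {p} {prev} {h} h∈ with ∈-mapMaybe⁻ (pick p prev) (subsetsOf (B p)) h∈
  ... | S , eq with find-sound (InClass? p S) (prev ++ allFin m) eq
  ... | good , refl = eq , good

  pick-select : ∀ {p prev h h′} → pick p prev (ℋ h ∩ B p) ≡ just h′ →
                h′ ∈ˡ select p prev × h ≈[ p ] h′
  pick-select {p} {prev} {h} eq =
    ∈-mapMaybe⁺ (pick p prev) (subsetsOf (B p)) (∈-subsetsOf (ℋ h) (B p)) eq ,
    sym (proj₂ (find-sound (InClass? p (ℋ h ∩ B p)) (prev ++ allFin m) eq))

  opaque
    rep-good : ∀ {p h} → Rep p h → Good p h
    rep-good {p} {h} h∈ with reps-select p
    ... | prev , eq = proj₂ (select-pick {prev = prev} (subst (h ∈ˡ_) eq h∈))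

  opaque
    rep-unique : ∀ {p h h′} → Rep p h → Rep p h′ → h ≈[ p ] h′ → h ≡ h′
    rep-unique {p} {h} {h′} h∈ h′∈ same with reps-select p
    ... | prev , eq
      with select-pick {prev = prev} (subst (h ∈ˡ_) eq h∈) | select-pick {prev = prev} (subst (h′ ∈ˡ_) eq h′∈)
    ... | e , _ | e′ , _ = just-injective (trans (sym e) (trans (cong (pick p prev) same) e′))

  opaque
    rep-exists : ∀ {p h} → Good p h → ∃ λ r → Rep p r × h ≈[ p ] r
    rep-exists {p} {h} good with reps-select p
    ... | prev , eq
      with find-complete (InClass? p (ℋ h ∩ B p)) (prev ++ allFin m) (∈-++⁺ʳ prev (∈-allFin h)) (good , refl)
    ... | r , e with pick-select {prev = prev} e
    ... | r∈ , same = r , subst (r ∈ˡ_) (sym eq) r∈ , same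

  opaque
    -- `h` lies in the preferred prefix and has the right trace, so the search stops within that
    -- prefix, possibly at another hyperedge.
    rep-inherited : ∀ {p h} → p ≢ root → Good p h → Rep (par p) h →
                    ∃ λ r → Rep p r × Rep (par p) r × h ≈[ p ] r
    rep-inherited {p} {h} p≢ good h∈
      with find-prefix (InClass? p (ℋ h ∩ B p)) (reps (par p)) (allFin m) h∈ (good , refl)
    ... | r , e , r∈par with pick-select {prev = reps (par p)} e
    ... | r∈ , same = r , subst (r ∈ˡ_) (sym (reps-par p≢)) r∈ , r∈par , same

  rep-kept : ∀ {p h} → Rep p h → Kept h
  rep-kept = proj₁ ∘ rep-good

  rep-meets : ∀ {p h} → Rep p h → Meets p h
  rep-meets = proj₁ ∘ proj₂ ∘ rep-good

  rep-maximal : ∀ {p h h′} → Rep p h → Kept h′ → h ≤[ p ] h′ → h′ ≤[ p ] h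
  rep-maximal {h′ = h′} h∈ = proj₂ (proj₂ (rep-good h∈)) h′

  -- Passing between a node and its parent

  Agree : Fin N → Fin m → Fin m → Set
  Agree p h r = h ≈[ p ] r × (∀ {v} → ¬ V p v → (v ∈ ℋ h → v ∈ ℋ r) × (v ∈ ℋ r → v ∈ ℋ h))

  opaque
    -- Let `h′` be maximal above `h` and let `r` represent its trace. If `h` is not below `r` inside
    -- `V p`, then outside `V p` it is contained in `r`. Nor is `r` below `h′` inside `V p`, since
    -- maximality of `r` would put `h` below `r`; so outside `V p`, `r` is contained in `h′`.
    -- Altogether `h` is contained in `h′`, and the antichain property gives `h ≡ h′`.
    cover : ∀ {p h} → Kept h → Meets p h →
            (∃ λ r → Rep p r × h ≤[ p ] r) ⊎ (Good p h × ∃ λ r → Rep p r × Agree p h r)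
    cover {p} {h} kh (u , u∈h , u∈B)
      with maximal-above {P = Kept} {_≲_ = λ a b → a ≤[ p ] b} Kept? (λ a b → ≤[]? a p b)
             (λ _ _ → id) ≤[]-trans h kh
    ... | h′ , kh′ , h≤h′ , max
      with rep-exists (kh′ , (u , h≤h′ u (B⊆V u∈B) u∈h , u∈B) , max)
    ... | r , r∈ , same with ≤[]? h p r
    ... | yes h≤r = inj₁ (r , r∈ , h≤r)
    ... | no h≰r  = inj₂ (subst (Good p) (sym h≡h′) good′ , r , r∈ ,
                      subst (_≈[ p ] r) (sym h≡h′) same ,
                      λ ¬Vv → (λ v∈ → h∖ v∈ ¬Vv) , λ v∈ → subst (λ k → _ ∈ ℋ k) (sym h≡h′) (r∖ v∈ ¬Vv))
      where
      good′ : Good p h′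
      good′ = kh′ , (u , h≤h′ u (B⊆V u∈B) u∈h , u∈B) , max

      r≰h′ : ¬ r ≤[ p ] h′
      r≰h′ r≤h′ = h≰r (≤[]-trans h≤h′ (rep-maximal r∈ kh′ r≤h′))

      h∖ : ∀ {v} → v ∈ ℋ h → ¬ V p v → v ∈ ℋ r
      h∖ = difference-below (λ v∈B v∈h → ≈[]-to {h′} {p} {r} same v∈B (h≤h′ _ (B⊆V v∈B) v∈h)) h≰r

      r∖ : ∀ {v} → v ∈ ℋ r → ¬ V p v → v ∈ ℋ h′
      r∖ = difference-below (≈[]-to {r} {p} {h′} (sym same)) r≰h′

      h⊆h′ : ℋ h ⊆ ℋ h′
      h⊆h′ {v} v∈ with V? p v
      ... | yes Vv = h≤h′ v Vv v∈
      ... | no ¬Vv = r∖ (h∖ v∈ ¬Vv) ¬Vv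

      h≡h′ : h ≡ h′
      h≡h′ = kept-antichain kh kh′ h⊆h′

  opaque
    agree-⊆ : ∀ {p h r} → Agree p h r → ∀ {v} → v ∈ ℋ h → v ∉ ℋ r → V p v × v ∉ B p
    agree-⊆ {p} {h} {r} (same , outside-V) {v} v∈h v∉r =
      decidable-stable (V? p v) (λ ¬Vv → v∉r (proj₁ (outside-V ¬Vv) v∈h)) ,
      λ v∈B → v∉r (≈[]-to {h} {p} {r} same v∈B v∈h)

  opaque
    -- A representative that coincides with `r` inside `V w` makes `r` good at `w`, so it is
    -- inherited; the final alternative records that one new at `w` is strictly larger there.
    descend : ∀ {w r u} → w ≢ root → Rep (par w) r → u ∈ ℋ r → V w u →
              ∃ λ r′ → Rep w r′ × r ≤[ w ] r′ × (Rep (par w) r′ ⊎ ¬ r′ ≤[ w ] r)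
    descend {w} {r} {u} w≢ r∈ u∈r Vu
      with cover {w} (rep-kept r∈) (meets-child w≢ (rep-meets r∈) u∈r Vu)
    ... | inj₁ (r′ , r′∈ , r≤r′) with ≤[]? r′ w r
    ...   | no r′≰r = r′ , r′∈ , r≤r′ , inj₂ r′≰r
    ...   | yes r′≤r with rep-inherited w≢ (Good-resp (rep-good r′∈) (rep-kept r∈) r′≤r r≤r′) r∈
    ...     | r₃ , r₃∈ , r₃∈par , same =
                r′ , r′∈ , r≤r′ , inj₁ (subst (Rep (par w)) (sym r′≡r₃) r₃∈par)
      where
      r′≡r₃ : r′ ≡ r₃
      r′≡r₃ = rep-unique r′∈ r₃∈ (trans (≤≥⇒≈ {r′} {w} {r} r′≤r r≤r′) same)
    descend {w} {r} {u} w≢ r∈ u∈r Vu | inj₂ (good , r′ , r′∈ , same , outside-V)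
      with rep-inherited w≢ good r∈
    ... | r₃ , r₃∈ , r₃∈par , same₃ = r , subst (Rep w) (sym r≡r′) r′∈ , (λ _ _ → id) , inj₁ r∈
      where
      r₃≡r′ : r₃ ≡ r′
      r₃≡r′ = rep-unique r₃∈ r′∈ (trans (sym same₃) same)

      -- A vertex of the parent's bag that occurs below `w` lies in `B w` by `exit`; any other is
      -- outside `V w`. Hence `r` and `r′` have equal traces at the parent, where both are
      -- representatives.
      to : ∀ {v} → v ∈ B (par w) → v ∈ ℋ r → v ∈ ℋ r′
      to {v} v∈B v∈r with V? w v
      ... | yes Vv = ≈[]-to {r} {w} {r′} same (proj₁ (exit Vv v∈B (par⋡ w≢))) v∈r
      ... | no ¬Vv = proj₁ (outside-V ¬Vv) v∈r

      from : ∀ {v} → v ∈ B (par w) → v ∈ ℋ r′ → v ∈ ℋ r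
      from {v} v∈B v∈r′ with V? w v
      ... | yes Vv = ≈[]-to {r′} {w} {r} (sym same) (proj₁ (exit Vv v∈B (par⋡ w≢))) v∈r′
      ... | no ¬Vv = proj₂ (outside-V ¬Vv) v∈r′

      r≡r′ : r ≡ r′
      r≡r′ = rep-unique r∈ (subst (Rep (par w)) r₃≡r′ r₃∈par) (≈[]-from {r} {par w} {r′} to from)

  opaque
    -- Otherwise maximality makes `h` and `r` coincide inside `V q`, so `r` is good at `q` and the
    -- representative with this trace, namely `h`, is inherited from the parent.
    uncovered-by-parent : ∀ {q h r} → q ≢ root → Rep q h → ¬ Rep (par q) h → Rep (par q) r → ¬ h ≤[ q ] r
    uncovered-by-parent {q} {h} {r} q≢ h∈ h∉par r∈ h≤r
      with rep-maximal h∈ (rep-kept r∈) h≤r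
    ... | r≤h with rep-inherited q≢ (Good-resp (rep-good h∈) (rep-kept r∈) h≤r r≤h) r∈
    ... | r₃ , r₃∈ , r₃∈par , same =
      h∉par (subst (Rep (par q)) (sym (rep-unique h∈ r₃∈ (trans (≤≥⇒≈ {h} {q} {r} h≤r r≤h) same))) r₃∈par)

  opaque
    -- `uncovered-by-parent` excludes the first case of `cover` at the parent. In the second, the
    -- difference of `h` and `r` avoids the parent's bag and has a vertex in `V q`, so non-piercing
    -- confines it to `V q`.
    ascend : ∀ {q h} → q ≢ root → Rep q h → ¬ Rep (par q) h → Meets (par q) h →
             Good (par q) h × ∃ λ r → Rep (par q) r × Agree (par q) h r ×
               ¬ h ≤[ q ] r × (∀ {v} → v ∈ ℋ h → v ∉ ℋ r → V q v)
    ascend {q} {h} q≢ h∈ h∉par meets with cover (rep-kept h∈) meets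
    ... | inj₁ (r , r∈ , h≤r) =
      contradiction (≤[]-mono (par≼ q≢) h≤r) (uncovered-by-parent q≢ h∈ h∉par r∈)
    ... | inj₂ (good , r , r∈ , agree) with uncovered-by-parent q≢ h∈ h∉par r∈
    ... | h≰r with ≰[]-witness h≰r
    ... | u , Vu , u∈h , u∉r = good , r , r∈ , agree , h≰r ,
      λ v∈h v∉r → confine-par q (ℋ-nonPiercing h r)
        (λ (x∈h , x∉r) → proj₂ (agree-⊆ {h = h} {r} agree x∈h x∉r)) (u∈h , u∉r) Vu (v∈h , v∉r)

  -- The subtree of nodes represented by a fixed hyperedge

  -- A certificate that `h` is not a representative, chosen to persist down the tree as long as `h`
  -- has vertices there.
  Blocked : Fin N → Fin m → Set
  Blocked p h = ∃ λ r → Rep p r × r ≢ h × h ≤[ p ] r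

  blocked⇒¬rep : ∀ {p h} → Blocked p h → ¬ Rep p h
  blocked⇒¬rep {p} {h} (r , r∈ , r≢h , h≤r) h∈ =
    r≢h (rep-unique r∈ h∈ (≤≥⇒≈ {r} {p} {h} (rep-maximal h∈ (rep-kept r∈) h≤r) h≤r))

  opaque
    -- Descend from the blocking `r`. The result is not `h`: if inherited, `h` would represent the
    -- blocked parent, and if strictly larger than `r`, it is not below `r` as `h` is.
    blocked-below : ∀ {w h u} → w ≢ root → Blocked (par w) h → u ∈ ℋ h → V w u → Blocked w h
    blocked-below {w} {h} {u} w≢ blocked@(r , r∈ , r≢h , h≤r) u∈h Vu
      with descend w≢ r∈ (h≤r u (V-mono (par≼ w≢) Vu) u∈h) Vu
    ... | r′ , r′∈ , r≤r′ , alt = r′ , r′∈ , r′≢h alt , ≤[]-trans h≤[w]r r≤r′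
      where
      h≤[w]r : h ≤[ w ] r
      h≤[w]r = ≤[]-mono (par≼ w≢) h≤r

      r′≢h : Rep (par w) r′ ⊎ ¬ r′ ≤[ w ] r → r′ ≢ h
      r′≢h (inj₁ r′∈par) refl = blocked⇒¬rep blocked r′∈par
      r′≢h (inj₂ r′≰r)   refl = r′≰r h≤[w]r

  opaque
    rep-or-blocked : ∀ {q w h u} → Rep q h → q ≼ w → u ∈ ℋ h → V w u → Rep w h ⊎ Blocked w h
    rep-or-blocked h∈ ≼-refl u∈h Vu = inj₁ h∈
    rep-or-blocked {h = h} h∈ (below w≢ q≼) u∈h Vu
      with rep-or-blocked h∈ q≼ u∈h (V-mono (par≼ w≢) Vu)
    ... | inj₂ blocked = inj₂ (blocked-below w≢ blocked u∈h Vu)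
    ... | inj₁ h∈par with descend w≢ h∈par u∈h Vu
    ... | r , r∈ , h≤r , _ with r ≟ h
    ... | yes refl = inj₁ r∈
    ... | no r≢h   = inj₂ (r , r∈ , r≢h , h≤r)

  TopRep : Fin m → Fin N → Set
  TopRep h q = Rep q h × (q ≢ root → ¬ Rep (par q) h)

  opaque
    topRep-exists : ∀ q {h} → Rep q h → ∃ (TopRep h)
    topRep-exists q {h} = tree-rec (λ q → Rep q h → ∃ (TopRep h)) go q
      where
      go : ∀ q → (q ≢ root → Rep (par q) h → ∃ (TopRep h)) → Rep q h → ∃ (TopRep h)
      go q ih h∈ with q ≟ root
      ... | yes q≡ = q , h∈ , λ q≢ → contradiction q≡ q≢
      ... | no q≢ with Rep? (par q) h
      ... | yes h∈par = ih q≢ h∈par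
      ... | no h∉par  = q , h∈ , λ _ → h∉par

  opaque
    -- At the parent of a lower top, `h` would be blocked, and it would remain blocked at that top.
    topRep-≼ : ∀ {h q q′} → TopRep h q → TopRep h q′ → q ≼ q′ → q ≡ q′
    topRep-≼ _ _ ≼-refl = refl
    topRep-≼ (h∈ , _) (h∈′ , top′) (below q′≢ q≼) with rep-meets h∈′
    ... | u , u∈h , u∈B with rep-or-blocked h∈ q≼ u∈h (V-mono (par≼ q′≢) (B⊆V u∈B))
    ... | inj₁ h∈par   = contradiction h∈par (top′ q′≢)
    ... | inj₂ blocked = contradiction h∈′ (blocked⇒¬rep (blocked-below q′≢ blocked u∈h (B⊆V u∈B)))

  opaque
    rep-meets-par : ∀ {h q q′} → Rep q h → Rep q′ h → ¬ q ≼ q′ → Meets (par q) h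
    rep-meets-par {h} {q} {q′} h∈ h∈′ q⋠q′ with rep-meets h∈ | rep-meets h∈′
    ... | u , u∈h , u∈B | w , w∈h , w∈B = meets-par u∈h (B⊆V u∈B) w∈h side
      where
      side : w ∈ B (par q) ⊎ ¬ V q w
      side with V? q w
      ... | yes Vw = inj₁ (proj₂ (proj₂ (exit Vw w∈B q⋠q′)))
      ... | no ¬Vw = inj₂ ¬Vw

  opaque
    incomparable-V : ∀ {q z v} → V q v → V z v → ¬ q ≼ z → ¬ z ≼ q → v ∈ B (par q)
    incomparable-V {q} Vq (i , z≼i , v∈i) q⋠z z⋠q with q ≼? i
    ... | yes q≼i = contradiction (≼-comparable q≼i z≼i) [ q⋠z , z⋠q ]′
    ... | no q⋠i  = proj₂ (proj₂ (exit Vq v∈i q⋠i))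

  opaque
    ≢root-of-⋠ : ∀ {q z} → ¬ q ≼ z → q ≢ root
    ≢root-of-⋠ {z = z} q⋠z refl = q⋠z (root≼ z)

  opaque
    -- If this fails, `q` and `par q′` are incomparable. What `h` has outside `r` lies in `V q` and
    -- off `B (par q)`, hence off `V (par q′)`, so `h` is below `r` there and maximality makes them
    -- coincide. Outside `V (par q′)`, `r` is contained in `r′`, which agrees with `h`. So `r` is
    -- contained in `h` and equals it, contradicting the choice of `r`.
    topRep-par-≼ : ∀ {h q q′} → TopRep h q → TopRep h q′ → ¬ q ≼ q′ → ¬ q′ ≼ q → par q′ ≼ par q
    topRep-par-≼ {h} {q} {q′} (h∈ , top) (h∈′ , top′) q⋠q′ q′⋠q
      with ≢root-of-⋠ q⋠q′ | ≢root-of-⋠ q′⋠q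
    ... | q≢ | q′≢
      with ascend q≢ h∈ (top q≢) (rep-meets-par h∈ h∈′ q⋠q′)
         | ascend q′≢ h∈′ (top′ q′≢) (rep-meets-par h∈′ h∈ q′⋠q)
    ... | _ , r , r∈ , agree , h≰r , h∖r
        | (_ , _ , max′) , r′ , r′∈ , agree′ , h≰r′ , _ =
      decidable-stable (par q′ ≼? par q) λ p′⋠p → h≢r (sym (r≡h p′⋠p))
      where
      h≢r : h ≢ r
      h≢r refl = h≰r λ _ _ → id

      h≤r : ¬ par q′ ≼ par q → h ≤[ par q′ ] r
      h≤r p′⋠p v Vv v∈h = decidable-stable (v ∈? ℋ r) λ v∉r →
        proj₂ (agree-⊆ {h = h} {r} agree v∈h v∉r)
          (incomparable-V (h∖r v∈h v∉r) Vv (λ q≼p′ → q⋠q′ (≼-trans q≼p′ (par≼ q′≢))) p′⋠q)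
        where
        p′⋠q : ¬ par q′ ≼ q
        p′⋠q p′≼q with par q′ ≟ q
        ... | yes refl = q⋠q′ (par≼ q′≢)
        ... | no p′≢q  = p′⋠p (proj₂ (≼-up p′≼q p′≢q))

      r≡h : ¬ par q′ ≼ par q → r ≡ h
      r≡h p′⋠p = kept-antichain (rep-kept r∈) (rep-kept h∈) r⊆h
        where
        r≤h : r ≤[ par q′ ] h
        r≤h = max′ r (rep-kept r∈) (h≤r p′⋠p)

        r≰r′ : ¬ r ≤[ par q′ ] r′
        r≰r′ r≤r′ = h≰r′ (≤[]-mono (par≼ q′≢) (≤[]-trans (h≤r p′⋠p) r≤r′))

        r⊆h : ℋ r ⊆ ℋ h
        r⊆h {v} v∈r with V? (par q′) v
        ... | yes Vv = r≤h v Vv v∈r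
        ... | no ¬Vv = proj₂ (proj₂ agree′ ¬Vv) (difference-below
                (λ x∈B x∈r → ≈[]-to {h} {par q′} {r′} (proj₁ agree′) x∈B (r≤h _ (B⊆V x∈B) x∈r))
                r≰r′ v∈r ¬Vv)

  opaque
    -- Incomparable tops have the same parent, where both replacements have the trace of `h` and so
    -- coincide. The nonempty difference of `h` and `r` then lies in both `V q` and `V q′`, hence
    -- meets the parent's bag, on which `h` and `r` agree.
    topRep-unique : ∀ {h q q′} → TopRep h q → TopRep h q′ → q ≡ q′
    topRep-unique {h} {q} {q′} t@(h∈ , top) t′@(h∈′ , top′) with q ≼? q′ | q′ ≼? q
    ... | yes q≼q′ | _        = topRep-≼ t t′ q≼q′
    ... | no _     | yes q′≼q = sym (topRep-≼ t′ t q′≼q)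
    ... | no q⋠q′  | no q′⋠q
      with ≢root-of-⋠ q⋠q′ | ≢root-of-⋠ q′⋠q
         | ≼-antisym (topRep-par-≼ t′ t q′⋠q q⋠q′) (topRep-par-≼ t t′ q⋠q′ q′⋠q)
    ... | q≢ | q′≢ | p≡p′
      with ascend q≢ h∈ (top q≢) (rep-meets-par h∈ h∈′ q⋠q′)
         | ascend q′≢ h∈′ (top′ q′≢) (rep-meets-par h∈′ h∈ q′⋠q)
    ... | _ , r , r∈ , agree , h≰r , h∖r | _ , r′ , r′∈ , agree′ , _ , h∖r′
      with rep-unique r∈ (subst (λ p → Rep p r′) (sym p≡p′) r′∈)
             (trans (sym (proj₁ agree)) (subst (λ p → h ≈[ p ] r′) (sym p≡p′) (proj₁ agree′)))
         | ≰[]-witness h≰r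
    ... | refl | u , Vu , u∈h , u∉r = contradiction
          (incomparable-V Vu (h∖r′ u∈h u∉r) q⋠q′ q′⋠q) (proj₂ (agree-⊆ {h = h} {r} agree u∈h u∉r))

  -- The support and its tree decomposition

  Near : Fin N → Fin m → Set
  Near q h = Rep q h ⊎ Rep (par q) h

  Covers : Fin N → Fin m → Set
  Covers q h = ∀ v → v ∈ ℋ h → ∃ λ r → Near q r × v ∈ ℋ r

  -- An invariant for a descent from the root, where nothing lies outside `V root`.
  Pending : Fin m → Fin N → Set
  Pending h q = (∃ λ u → u ∈ ℋ h × V q u) ×
                (∀ v → v ∈ ℋ h → ¬ V q v → ∃ λ r → Rep (par q) r × v ∈ ℋ r)

  Pending? : ∀ h q → Dec (Pending h q)
  Pending? h q = (any? λ u → (u ∈? ℋ h) ×-dec V? q u) ×-dec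
    (all? λ v → (v ∈? ℋ h) →-dec (¬? (V? q v) →-dec
      (any? λ r → Rep? (par q) r ×-dec (v ∈? ℋ r))))

  child-containing : ∀ {q v} → V q v → v ∉ B q → ∃ λ c → c ≢ root × par c ≡ q × V c v
  child-containing {q} {v} (i , q≼i , v∈i) v∉q
    with child-towards q≼i (λ q≡i → v∉q (subst (λ j → v ∈ B j) (sym q≡i) v∈i))
  ... | c , c≢ , eq , c≼i = c , c≢ , eq , i , c≼i , v∈i

  -- If `h` misses `B q`, it lies in `V c` for one child `c`. If it agrees with `r` without being
  -- contained in it, the excess lies in `V c` for one child and `r` covers the rest. Either way `c`
  -- would be pending.
  covers-deepest : ∀ {h q} → Kept h → Pending h q →
                   (∀ c → c ≢ root → par c ≡ q → ¬ Pending h c) → Covers q h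
  covers-deepest {h} {q} kh ((u , u∈h , Vu) , pend) deepest with Meets? q h
  ... | no ¬meets with child-containing Vu (avoids ¬meets u∈h)
  ...   | c , c≢ , refl , Vcu = contradiction
            ((u , u∈h , Vcu) , λ v v∈h ¬Vv → contradiction
              (confine-par c (ℋ-connected h) (avoids ¬meets) u∈h Vcu v∈h) ¬Vv)
            (deepest c c≢ refl)
  covers-deepest {h} {q} kh ((u , u∈h , Vu) , pend) deepest | yes meets with cover kh meets
  ... | inj₁ (r , r∈ , h≤r) = covered
    where
    covered : Covers q h
    covered v v∈h with V? q v
    ... | yes Vv = r , inj₁ r∈ , h≤r v Vv v∈h
    ... | no ¬Vv with pend v v∈h ¬Vv
    ... | r′ , r′∈ , v∈r′ = r′ , inj₂ r′∈ , v∈r′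
  ... | inj₂ (_ , r , r∈ , agree) with any? (λ x → (x ∈? ℋ h) ×-dec ¬? (x ∈? ℋ r))
  ...   | no h⊆r = λ v v∈h → r , inj₁ r∈ , decidable-stable (v ∈? ℋ r) λ v∉r → h⊆r (v , v∈h , v∉r)
  ...   | yes (x , x∈h , x∉r) with agree-⊆ {h = h} {r} agree x∈h x∉r
  ...     | Vx , x∉B with child-containing Vx x∉B
  ...       | c , c≢ , refl , Vcx = contradiction
                ((x , x∈h , Vcx) , λ v v∈h ¬Vv → r , r∈ , decidable-stable (v ∈? ℋ r) λ v∉r →
                  ¬Vv (confine-par c (ℋ-nonPiercing h r)
                    (λ (y∈h , y∉r) → proj₂ (agree-⊆ {h = h} {r} agree y∈h y∉r))
                    (x∈h , x∉r) Vcx (v∈h , v∉r)))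
                (deepest c c≢ refl)

  opaque
    -- A representative is attached at one of its own nodes, to keep its bags connected. An empty
    -- hyperedge goes to the root by default, any other to a pending node of greatest depth.
    attach : ∀ {h} → Kept h → ∃ λ q → Covers q h × (∀ {q′} → Rep q′ h → Near q h)
    attach {h} kh with any? (λ q → Rep? q h)
    ... | yes (q , h∈) = q , (λ _ v∈h → h , inj₁ h∈ , v∈h) , λ _ → inj₁ h∈
    ... | no ¬rep with any? (_∈? ℋ h)
    ...   | no empty = root , (λ _ v∈h → contradiction (_ , v∈h) empty) , λ h∈ → contradiction (_ , h∈) ¬rep
    ...   | yes (u , u∈h)
      with maximal-above {P = Pending h} {_≲_ = λ i j → dep i ≤ dep j}
             (Pending? h) (λ i j → dep i ℕ.≤? dep j) ℕ.≤-refl ℕ.≤-trans root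
             ((u , u∈h , in-root u) , λ v _ ¬Vv → contradiction (in-root v) ¬Vv)
      where
      in-root : ∀ v → V root v
      in-root v with covV v
      ... | i , v∈i = i , root≼ i , v∈i
    ...     | q , pend , _ , max = q ,
      covers-deepest kh pend (λ { c c≢ refl pend-c →
        ℕ.<-irrefl refl (ℕ.≤-trans (dep-< c≢) (max c pend-c (ℕ.<⇒≤ (dep-< c≢)))) }) ,
      λ h∈ → contradiction (_ , h∈) ¬rep

  -- A discarded hyperedge also gets a leaf, at the node chosen for a kept hyperedge containing it.
  att : Fin m → Fin N
  att h = proj₁ (attach (proj₁ (proj₂ (keep h))))

  att-covers : ∀ h → Covers (att h) h
  att-covers h v v∈h with keep h
  ... | k , kk , h⊆k = proj₁ (proj₂ (attach kk)) v (h⊆k v∈h)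

  att-near : ∀ {h q} → Rep q h → Near (att h) h
  att-near {h} {q} h∈ with keep h
  ... | k , kk , h⊆k with kept-antichain (rep-kept h∈) kk h⊆k
  ... | refl = proj₂ (proj₂ (attach kk)) h∈

  -- With the parent's list included, a representative and its replacement across a tree edge share
  -- a bag.
  nodeBag : Fin N → Subset m
  nodeBag q = fromList (reps q ++ reps (par q))

  nodeBag⁺ : ∀ {q h} → Near q h → h ∈ nodeBag q
  nodeBag⁺ (inj₁ h∈) = ∈-fromList⁺ (∈-++⁺ˡ h∈)
  nodeBag⁺ {q} (inj₂ h∈) = ∈-fromList⁺ (∈-++⁺ʳ (reps q) h∈)

  nodeBag⁻ : ∀ {q h} → h ∈ nodeBag q → Near q h
  nodeBag⁻ {q} h∈ = ∈-++⁻ (reps q) (∈-fromList⁻ (reps q ++ reps (par q)) h∈)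

  leafBag : Fin m → Subset m
  leafBag h = ⁅ h ⁆ ∪ nodeBag (att h)

  bag : Fin (N + m) → Subset m
  bag = onNodes tree att nodeBag leafBag

  ∈-node⁺ : ∀ {i h} → h ∈ nodeBag i → h ∈ bag (i ↑ˡ m)
  ∈-node⁺ {i} = subst (_ ∈_) (sym (onNodes-node tree att i))

  ∈-node⁻ : ∀ {i h} → h ∈ bag (i ↑ˡ m) → h ∈ nodeBag i
  ∈-node⁻ {i} = subst (_ ∈_) (onNodes-node tree att i)

  ∈-leaf⁺ : ∀ {k h} → h ∈ leafBag k → h ∈ bag (N ↑ʳ k)
  ∈-leaf⁺ {k} = subst (_ ∈_) (sym (onNodes-leaf tree att k))

  ∈-leaf⁻ : ∀ {k h} → h ∈ bag (N ↑ʳ k) → h ∈ leafBag k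
  ∈-leaf⁻ {k} = subst (_ ∈_) (onNodes-leaf tree att k)

  Q : Graph m
  Q = record
    { Adj    = λ h h′ → h ≢ h′ × ∃ λ x → h ∈ bag x × h′ ∈ bag x
    ; sym    = λ (h≢h′ , x , h∈ , h′∈) → h≢h′ ∘ sym , x , h′∈ , h∈
    ; irrefl = λ (h≢h , _) → h≢h refl
    }

  -- Connectivity of the support

  module _ {v : Fin n} where

    Linked : Fin m → Fin m → Set
    Linked = Walk (Graph.Adj Q) (λ h → v ∈ ℋ h)

    link : ∀ {x h h′} → h ∈ bag x → h′ ∈ bag x → v ∈ ℋ h → v ∈ ℋ h′ → Linked h h′
    link {x} {h} {h′} h∈ h′∈ v∈h v∈h′ with h ≟ h′
    ... | yes refl = here v∈h
    ... | no h≢h′  = step v∈h (h≢h′ , x , h∈ , h′∈) (here v∈h′)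

    link-near : ∀ {q h h′} → Near q h → Near q h′ → v ∈ ℋ h → v ∈ ℋ h′ → Linked h h′
    link-near near near′ = link (∈-node⁺ (nodeBag⁺ near)) (∈-node⁺ (nodeBag⁺ near′))

    link-down : ∀ {q z r} → q ≼ z → V z v → Rep q r → v ∈ ℋ r →
                ∃ λ r′ → Rep z r′ × v ∈ ℋ r′ × Linked r r′
    link-down ≼-refl Vv r∈ v∈r = _ , r∈ , v∈r , here v∈r
    link-down (below z≢ q≼) Vv r∈ v∈r with link-down q≼ (V-mono (par≼ z≢) Vv) r∈ v∈r
    ... | r′ , r′∈ , v∈r′ , walk with descend z≢ r′∈ v∈r′ Vv
    ... | r″ , r″∈ , r′≤r″ , _ =
      r″ , r″∈ , r′≤r″ v Vv v∈r′ , walk ◅◅ link-near (inj₂ r′∈) (inj₁ r″∈) v∈r′ (r′≤r″ v Vv v∈r′)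

    -- The replacement given by `ascend` loses only vertices of `V q` off the parent's bag. As `v`
    -- also occurs at `x`, outside the subtree of `q`, it is not among them.
    link-up : ∀ {q x r} → v ∈ B x → ¬ q ≼ x → Rep q r → v ∈ ℋ r →
              ∃ λ r′ → Rep (par q) r′ × v ∈ ℋ r′ × Linked r r′
    link-up {q} {x} {r} v∈x q⋠x r∈ v∈r with Rep? (par q) r
    ... | yes r∈par = r , r∈par , v∈r , here v∈r
    ... | no r∉par with rep-meets r∈
    ... | u , u∈r , u∈B with ascend (≢root-of-⋠ q⋠x) r∈ r∉par (meets-par u∈r (B⊆V u∈B) v∈r side)
      where
      side : v ∈ B (par q) ⊎ ¬ V q v
      side with V? q v
      ... | yes Vv = inj₁ (proj₂ (proj₂ (exit Vv v∈x q⋠x)))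
      ... | no ¬Vv = inj₂ ¬Vv
    ... | _ , r′ , r′∈ , agree , _ , r∖r′ = r′ , r′∈ , v∈r′ , link-near (inj₁ r∈) (inj₂ r′∈) v∈r v∈r′
      where
      v∈r′ : v ∈ ℋ r′
      v∈r′ = decidable-stable (v ∈? ℋ r′) λ v∉r′ →
        proj₂ (agree-⊆ {h = r} {r′} agree v∈r v∉r′) (proj₂ (proj₂ (exit (r∖r′ v∈r v∉r′) v∈x q⋠x)))

    -- Climb until an ancestor of `x` is reached, then descend to `x`.
    link-to : ∀ {x} → v ∈ B x → ∀ q {r} → Rep q r → v ∈ ℋ r →
              ∃ λ r′ → Rep x r′ × v ∈ ℋ r′ × Linked r r′
    link-to {x} v∈x q = tree-rec X go q
      where
      X : Fin N → Set
      X q = ∀ {r} → Rep q r → v ∈ ℋ r → ∃ λ r′ → Rep x r′ × v ∈ ℋ r′ × Linked r r′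

      go : ∀ q → (q ≢ root → X (par q)) → X q
      go q ih r∈ v∈r with q ≼? x
      ... | yes q≼x = link-down q≼x (B⊆V v∈x) r∈ v∈r
      ... | no q⋠x with link-up v∈x q⋠x r∈ v∈r
      ... | r₁ , r₁∈ , v∈r₁ , walk₁ with ih (≢root-of-⋠ q⋠x) r₁∈ v∈r₁
      ... | r₂ , r₂∈ , v∈r₂ , walk₂ = r₂ , r₂∈ , v∈r₂ , walk₁ ◅◅ walk₂

    link-leaf : ∀ {x} → v ∈ B x → ∀ {h} → v ∈ ℋ h → ∃ λ r → Rep x r × v ∈ ℋ r × Linked h r
    link-leaf v∈x {h} v∈h with att-covers h v v∈h
    ... | r , near , v∈r with [ link-to v∈x (att h) , link-to v∈x (par (att h)) ]′ near v∈r
    ... | r′ , r′∈ , v∈r′ , walk = r′ , r′∈ , v∈r′ ,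
      link (∈-leaf⁺ (x∈p∪q⁺ (inj₁ (x∈⁅x⁆ h)))) (∈-leaf⁺ (x∈p∪q⁺ (inj₂ (nodeBag⁺ near)))) v∈h v∈r ◅◅ walk

  Q-support : DualSupport G ℋ Q
  Q-support v h h′ v∈h v∈h′ with covV v
  ... | x , v∈x with link-leaf v∈x v∈h | link-leaf v∈x v∈h′
  ... | r , r∈ , v∈r , walk | r′ , r′∈ , v∈r′ , walk′ =
    walk ◅◅ link-near (inj₁ r∈) (inj₁ r′∈) v∈r v∈r′ ◅◅ walk-reverse (Graph.sym Q) walk′

  -- Coherence and width

  leafTree : Rooted (N + m)
  leafTree = attachLeaves tree att

  module Leafed = Rooted leafTree

  -- If `h` does not represent the parent, then `i` is the unique top. At the root, `par-root`
  -- identifies the two lists of the bag.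
  near-par : ∀ {h t i} → TopRep h t → Near i h → i ≢ t → i ≢ root × Near (par i) h
  near-par {h} {t} {i} top near i≢t with i ≟ root
  ... | yes refl = contradiction (topRep-unique (rep-root near , λ r≢ → contradiction refl r≢) top) i≢t
    where
    rep-root : Near root h → Rep root h
    rep-root (inj₁ h∈) = h∈
    rep-root (inj₂ h∈) = subst (λ p → Rep p h) par-root h∈
  ... | no i≢ with Rep? (par i) h
  ...   | yes h∈par = i≢ , inj₁ h∈par
  near-par top (inj₁ h∈)    i≢t | no i≢ | no h∉par = contradiction (topRep-unique (h∈ , λ _ → h∉par) top) i≢t
  near-par top (inj₂ h∈par) i≢t | no i≢ | no h∉par = contradiction h∈par h∉par

  -- A hyperedge that represents no node occurs only in its own leaf bag. Any other climbs to its
  -- unique top, and `att-near` joins its own leaf to the rest.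
  bag-coherent : ∀ h → Connected Leafed.Edge (λ x → h ∈ bag x)
  bag-coherent h with any? (λ q → Rep? q h)
  ... | no ¬rep = Leafed.connected-from-top (N ↑ʳ h) (leaf-cases tree att _ node leaf)
    where
    node : ∀ i → h ∈ bag (i ↑ˡ m) → _
    node i h∈ = contradiction (nodeBag⁻ (∈-node⁻ h∈)) [ (λ r → ¬rep (_ , r)) , (λ r → ¬rep (_ , r)) ]′

    leaf : ∀ k → h ∈ bag (N ↑ʳ k) → N ↑ʳ k ≢ N ↑ʳ h → _
    leaf k h∈ k≢h with x∈p∪q⁻ ⁅ k ⁆ _ (∈-leaf⁻ h∈)
    ... | inj₁ h∈k = contradiction (cong (N ↑ʳ_) (sym (x∈⁅y⁆⇒x≡y k h∈k))) k≢h
    ... | inj₂ h∈a = contradiction (nodeBag⁻ h∈a) [ (λ r → ¬rep (_ , r)) , (λ r → ¬rep (_ , r)) ]′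
  ... | yes (q , h∈q) with topRep-exists q h∈q
  ... | t , top = Leafed.connected-from-top (t ↑ˡ m) (leaf-cases tree att _ node leaf)
    where
    node : ∀ i → h ∈ bag (i ↑ˡ m) → i ↑ˡ m ≢ t ↑ˡ m → i ↑ˡ m ≢ Leafed.root × h ∈ bag (Leafed.par (i ↑ˡ m))
    node i h∈ i≢t with near-par top (nodeBag⁻ (∈-node⁻ h∈)) (i≢t ∘ cong (_↑ˡ m))
    ... | i≢ , near = i≢ ∘ Fin.↑ˡ-injective m i root ,
      subst (λ x → h ∈ bag x) (sym (onNodes-node tree att i)) (∈-node⁺ (nodeBag⁺ near))

    leaf : ∀ k → h ∈ bag (N ↑ʳ k) → N ↑ʳ k ≢ t ↑ˡ m → N ↑ʳ k ≢ Leafed.root × h ∈ bag (Leafed.par (N ↑ʳ k))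
    leaf k h∈ _ = leaf≢node tree att ,
      subst (λ x → h ∈ bag x) (sym (onNodes-leaf tree att k)) (∈-node⁺ (in-att (x∈p∪q⁻ ⁅ k ⁆ _ (∈-leaf⁻ h∈))))
      where
      in-att : h ∈ ⁅ k ⁆ ⊎ h ∈ nodeBag (att k) → h ∈ nodeBag (att k)
      in-att (inj₂ h∈a) = h∈a
      in-att (inj₁ h∈k) with x∈⁅y⁆⇒x≡y k h∈k
      ... | refl = nodeBag⁺ (att-near h∈q)

  length-reps : ∀ {t} → (∀ i → ∣ B i ∣ ≤ suc t) → ∀ p → length (reps p) ≤ 2 ^ suc t
  length-reps {t} width p with reps-select p
  ... | prev , eq = begin
    length (reps p)              ≡⟨ cong length eq ⟩
    length (select p prev)       ≤⟨ length-mapMaybe (pick p prev) (subsetsOf (B p)) ⟩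
    length (subsetsOf (B p))     ≡⟨ length-subsetsOf (B p) ⟩
    2 ^ ∣ B p ∣                  ≤⟨ ℕ.^-monoʳ-≤ 2 (width p) ⟩
    2 ^ suc t                    ∎
    where open ℕ.≤-Reasoning

  ∣nodeBag∣ : ∀ {t} → (∀ i → ∣ B i ∣ ≤ suc t) → ∀ p → ∣ nodeBag p ∣ ≤ 2 ^ (4 * suc t)
  ∣nodeBag∣ {t} width p = begin
    ∣ nodeBag p ∣                             ≤⟨ ∣fromList∣≤length (reps p ++ reps (par p)) ⟩
    length (reps p ++ reps (par p))           ≡⟨ length-++ (reps p) ⟩
    length (reps p) + length (reps (par p))   ≤⟨ ℕ.+-mono-≤ (length-reps width p) (length-reps width (par p)) ⟩
    2 ^ suc t + 2 ^ suc t                     ≡⟨ cong (2 ^ suc t +_) (sym (ℕ.+-identityʳ (2 ^ suc t))) ⟩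
    -- The exponent `t + 2` is at most `4 * suc t`.
    2 ^ suc (suc t)                           ≤⟨ ℕ.^-monoʳ-≤ 2 (ℕ.+-mono-≤ (s≤s (z≤n {t})) (ℕ.m≤m+n (suc t) _)) ⟩
    2 ^ (4 * suc t)                           ∎
    where open ℕ.≤-Reasoning

  Q-treewidth : ∀ {t} → (∀ i → ∣ B i ∣ ≤ suc t) → TwLeq Q (2 ^ (4 * suc t))
  Q-treewidth {t} width = record
    { m        = N + m
    ; T        = Leafed.toGraph
    ; isTree   = Leafed.toGraph-isTree
    ; bag      = bag
    ; covV     = λ h → N ↑ʳ h , ∈-leaf⁺ (x∈p∪q⁺ (inj₁ (x∈⁅x⁆ h)))
    ; covE     = λ _ _ → proj₂
    ; coherent = bag-coherent
    ; width    = leaf-cases tree att (λ x → ∣ bag x ∣ ≤ suc (2 ^ (4 * suc t)))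
        (λ i → subst (λ p → ∣ p ∣ ≤ suc (2 ^ (4 * suc t))) (sym (onNodes-node tree att i))
                 (ℕ.m≤n⇒m≤1+n (∣nodeBag∣ width i)))
        -- The hyperedge added at a leaf uses up the one unit by which bag size may exceed width.
        (λ h → subst (λ p → ∣ p ∣ ≤ suc (2 ^ (4 * suc t))) (sym (onNodes-leaf tree att h))
                 (ℕ.≤-trans (∣⁅x⁆∪p∣≤1+∣p∣ h (nodeBag (att h))) (s≤s (∣nodeBag∣ width (att h)))))
    }

theorem2 : {n m : ℕ} (G : Graph n) (t : ℕ) → HasTreewidth G t →
    (ℋ : Family n m) → ConnectedFamily G ℋ → NonPiercing G ℋ →
    Σ (Graph m) (λ Q → DualSupport G ℋ Q × TwLeq Q (2 ^ (4 * suc t)))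
theorem2 G t (decomposition , _) ℋ conn nonPiercing = Q , Q-support , Q-treewidth width
  where
  open TreeDecomposition decomposition using (T; isTree; covV; covE; coherent; width)

  rooted : Σ (Rooted _) λ R → ∀ {i j} → Graph.Adj T i j → Rooted.Edge R i j
  rooted = root-tree isTree

  open Construction G ℋ conn nonPiercing (proj₁ rooted) (TreeDecomposition.bag decomposition)
    covV covE (λ v i j i∈ j∈ → walk-map (proj₂ rooted) (coherent v i j i∈ j∈))
    using (Q; Q-support; Q-treewidth)
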